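{- Let $n > 2$ be an integer and $q = 2^n$. Let $L_{B_n}$ be the set of leaves of $G_q$ contained in $B_n$, and let $$T_{q+1} := \{\alpha \in \mathbb{F}_q^* : D_{q+1}(\alpha) = 0,\ D_{q+1}(\alpha^{ -1}) \neq 0\}.$$ Then $L_{B_n}$ is not empty and $T_{q+1} = L_{B_n}$.
   Context: $D_m(x) = \sum_{i=0}^{\lfloor m/2 \rfloor} \frac{m}{m-i}\binom{m-i}{i}(-1)^i x^{m-2i} \in \mathbb{F}_q[x]$ is the Dickson polynomial of the first kind of degree $m>0$ with parameter $1$ (the integer coefficients being reduced mod $2$); it satisfies $D_m(x+x^{ -1}) = x^m + x^{ -m}$. The map $\theta$ on $\mathbf{P}^1(\mathbb{F}_q) = \mathbb{F}_q \cup \{\infty\}$ is defined by $\theta(0) = \theta(\infty) = \infty$ and $\theta(x) = x + x^{ -1}$ otherwise. $G_q$ is the directed graph with vertex set $\mathbf{P}^1(\mathbb{F}_q)$ and an arrow from $\alpha$ to $\theta(\alpha)$ for each vertex $\alpha$. A leaf of $G_q$ is a vertex with no incoming arrow, i.e. not of the form $\theta(x)$ with $x \in \mathbf{P}^1(\mathbb{F}_q)$. $\mathrm{Tr}_n(x) = \sum_{j=0}^{n-1} x^{2^j}$ is the absolute trace on $\mathbb{F}_{2^n}$, and $B_n := \{\alpha \in \mathbb{F}_q^* : \mathrm{Tr}_n(\alpha) \neq \mathrm{Tr}_n(\alpha^{ -1})\}$. -}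

module Defs where

open import Algebra.Bundles using (CommutativeRing)
open import Algebra.Definitions using (Invertible)
import Algebra.Properties.Monoid.Mult as Mult
import Algebra.Properties.Monoid.Sum as Sum
import Algebra.Properties.Semiring.Exp as Exp
open import Data.Fin.Base using (Fin; toℕ)
open import Data.Fin.Properties as Fin using (toℕ<n)
open import Data.Maybe.Base using (Maybe; just; nothing)
open import Data.Maybe.Relation.Binary.Pointwise using (Pointwise)
open import Data.Nat.Base using (ℕ; zero; suc; _+_; _*_; _∸_; _^_; _<_; _/_; ⌊_/2⌋; NonZero; z<s; s<s; s≤s⁻¹; >-nonZero)
open import Data.Nat.Combinatorics using (_C_; nCk+nC[k+1]≡[n+1]C[k+1]; k>n⇒nCk≡0)
open import Data.Nat.Divisibility using (_∣_; divides; ∣m∣n⇒∣m+n; m∣m*n)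
open import Data.Nat.DivMod using (m/n*n≡m)
open import Data.Nat.Properties using (⌊n/2⌋<n; ≤-<-trans; m<n⇒0<n∸m; *-distribʳ-+; *-zeroʳ; m∸n+n≡m; <⇒≤)
open import Data.Nat.Tactic.RingSolver using (solve-∀)
open import Data.Product.Base using (Σ; ∃; _×_; _,_; proj₁)
open import Function.Bundles using (Inverse)
open import Function.Properties.Inverse using (Inverse⇒Injection)
open import Level using (Level; _⊔_) renaming (suc to lsuc)
open import Relation.Binary.Core using (Rel)
open import Relation.Binary.Definitions using (Decidable)
open import Relation.Binary.PropositionalEquality as ≡ using (_≡_; refl; sym; trans; cong; cong₂; subst)
open import Relation.Nullary.Decidable using (yes; no; via-injection)
open import Relation.Nullary.Negation using (¬_)
open import Relation.Unary using (Pred; _∩_)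

private
  variable
    c ℓ : Level

private
  i<m : ∀ m .{{_ : NonZero m}} (i : Fin (suc ⌊ m /2⌋)) → toℕ i < m
  i<m (suc m) i = ≤-<-trans (s≤s⁻¹ (toℕ<n i)) (⌊n/2⌋<n m)

m∸i-nonZero : ∀ m .{{_ : NonZero m}} (i : Fin (suc ⌊ m /2⌋)) → NonZero (m ∸ toℕ i)
m∸i-nonZero m i = >-nonZero (m<n⇒0<n∸m (i<m m i))

-- The absolute value (m / (m - i)) * binom (m - i) i of the i-th
-- coefficient.  The natural number division is exact: see
-- dicksonCoeff-exact.
dicksonCoeff : ∀ m .{{_ : NonZero m}} → Fin (suc ⌊ m /2⌋) → ℕ
dicksonCoeff m i = (m * ((m ∸ toℕ i) C toℕ i)) / (m ∸ toℕ i)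
  where instance _ = m∸i-nonZero m i

[k+1]*[n+1]C[k+1]≡[n+1]*nCk : ∀ n k → suc k * (suc n C suc k) ≡ suc n * (n C k)
[k+1]*[n+1]C[k+1]≡[n+1]*nCk zero    zero    = refl
[k+1]*[n+1]C[k+1]≡[n+1]*nCk zero    (suc k)
  rewrite k>n⇒nCk≡0 {1} {suc (suc k)} (s<s z<s) | k>n⇒nCk≡0 {0} {suc k} z<s = *-zeroʳ k
[k+1]*[n+1]C[k+1]≡[n+1]*nCk (suc n) zero
  rewrite sym (nCk+nC[k+1]≡[n+1]C[k+1] (suc n) 0) =
  cong suc ([k+1]*[n+1]C[k+1]≡[n+1]*nCk n 0)
[k+1]*[n+1]C[k+1]≡[n+1]*nCk (suc n) (suc k)
  rewrite sym (nCk+nC[k+1]≡[n+1]C[k+1] (suc n) (suc k)) =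
  trans (split (suc k) (suc n C suc k) (suc n C suc (suc k)))
  (trans (cong₂ (λ a b → a + b + (suc n C suc k))
           ([k+1]*[n+1]C[k+1]≡[n+1]*nCk n k) ([k+1]*[n+1]C[k+1]≡[n+1]*nCk n (suc k)))
  (trans (join (suc n) (n C k) (n C suc k) (suc n C suc k))
  (trans (cong (λ a → suc n * a + (suc n C suc k)) (nCk+nC[k+1]≡[n+1]C[k+1] n k))
         (final (suc n) (suc n C suc k)))))
  where
  split : ∀ k a b → suc k * (a + b) ≡ k * a + suc k * b + a
  split = solve-∀
  join : ∀ n a b d → n * a + n * b + d ≡ n * (a + b) + d
  join = solve-∀
  final : ∀ n a → n * a + a ≡ suc n * a
  final = solve-∀

private
  n∣k*nCk : ∀ n k → n ∣ k * (n C k)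
  n∣k*nCk n       zero    = divides 0 refl
  n∣k*nCk zero    (suc k) rewrite k>n⇒nCk≡0 {0} {suc k} z<s = divides 0 (*-zeroʳ k)
  n∣k*nCk (suc n) (suc k) = subst (suc n ∣_) (sym ([k+1]*[n+1]C[k+1]≡[n+1]*nCk n k)) (m∣m*n (n C k))

dicksonCoeff-exact : ∀ m .{{_ : NonZero m}} (i : Fin (suc ⌊ m /2⌋)) →
  dicksonCoeff m i * (m ∸ toℕ i) ≡ m * ((m ∸ toℕ i) C toℕ i)
dicksonCoeff-exact m i = m/n*n≡m (subst (d ∣_) eq (∣m∣n⇒∣m+n (m∣m*n b) (n∣k*nCk d (toℕ i))))
  where
  instance _ = m∸i-nonZero m i
  d = m ∸ toℕ i
  b = d C toℕ i
  eq : d * b + toℕ i * b ≡ m * b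
  eq = trans (sym (*-distribʳ-+ b d (toℕ i))) (cong (_* b) (m∸n+n≡m (<⇒≤ (i<m m i))))

record FiniteField c ℓ (q : ℕ) : Set (lsuc (c ⊔ ℓ)) where
  field
    commutativeRing : CommutativeRing c ℓ

  open CommutativeRing commutativeRing public
    renaming (_+_ to _⊕_; _*_ to _⊗_; -_ to ⊖_)
    hiding (_-_)

  field
    0≉1         : 0# ≉ 1#
    invertible  : ∀ x → x ≉ 0# → Invertible _≈_ 1# _⊗_ x
    enumeration : Inverse setoid (≡.setoid (Fin q))

  inv : ∀ x → x ≉ 0# → Carrier
  inv x x≉0 = proj₁ (invertible x x≉0)

  _≟_ : Decidable _≈_
  _≟_ = via-injection (Inverse⇒Injection enumeration) Fin._≟_

-- The point at infinity of the projective line P¹ below.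
pattern ∞ = nothing

module _ {q : ℕ} (F : FiniteField c ℓ q) where
  open FiniteField F
  open Mult +-monoid using () renaming (_×_ to _·_)
  open Sum +-monoid using (sum-syntax; sum⁺-syntax)
  open Exp semiring using () renaming (_^_ to _↑_)

  -- The value at x of the Dickson polynomial of the first kind D_m with
  -- parameter 1; its integer coefficients are mapped to F.
  D : ∀ m .{{_ : NonZero m}} → Carrier → Carrier
  D m x = ∑[ i ≤ ⌊ m /2⌋ ] ((dicksonCoeff m i · ((⊖ 1#) ↑ toℕ i)) ⊗ (x ↑ (m ∸ 2 * toℕ i)))

  Tr : ℕ → Carrier → Carrier
  Tr n x = ∑[ j < n ] (x ↑ (2 ^ toℕ j))

  P¹ : Set c
  P¹ = Maybe Carrier

  _≈ₚ_ : Rel P¹ (c ⊔ ℓ)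
  _≈ₚ_ = Pointwise _≈_

  θ : P¹ → P¹
  θ ∞ = ∞
  θ (just x) with x ≟ 0#
  ... | yes _  = ∞
  ... | no x≉0 = just (x ⊕ inv x x≉0)

  -- The arrow relation of G_q.
  _⟶_ : Rel P¹ (c ⊔ ℓ)
  α ⟶ β = θ α ≈ₚ β

  Leaf : Pred P¹ (c ⊔ ℓ)
  Leaf β = ¬ ∃ λ α → α ⟶ β

  B : ℕ → Pred Carrier ℓ
  B n α = Σ (α ≉ 0#) λ α≉0 → Tr n α ≉ Tr n (inv α α≉0)

  L-B : ℕ → Pred Carrier (c ⊔ ℓ)
  L-B n = (λ α → Leaf (just α)) ∩ B n

  T : ∀ m .{{_ : NonZero m}} → Pred Carrier ℓ
  T m α = Σ (α ≉ 0#) λ α≉0 → (D m α ≈ 0#) × (D m (inv α α≉0) ≉ 0#)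

{-# OPTIONS --safe #-}
module Submission where

-- In characteristic 2 the Dickson recurrence gives D₂ₘ = Dₘ² and D₂ₘ₊₁ = Dₘ Dₘ₊₁ + x, whence
-- D_{q+1}(α) = α²(1 + Tr(α⁻¹)) for α ∈ F_q*.  On the other hand α = x + x⁻¹ means that y = x/α
-- solves y² + y = α⁻², which by Hilbert 90 is possible exactly when Tr(α⁻¹) = 0.  So for α ≠ 0 both
-- "α is a leaf" and "D_{q+1}(α) = 0" say Tr(α⁻¹) = 1.  It remains to find w with
-- Tr(w) ≠ Tr(w⁻¹); then w or w⁻¹ lies in L_{B_n}.

open import Defs
open import Data.Nat.Base using (ℕ; suc; _^_; _>_)
open import Data.Product.Base using (_×_)
open import Relation.Unary using (Satisfiable; _≐_)

open import Algebra.Bundles using (CommutativeMonoid; CommutativeRing)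
import Algebra.Properties.CommutativeMonoid.Sum as CommutativeMonoidSum
import Algebra.Properties.Ring as RingProperties
import Algebra.Properties.Semiring.Exp as SemiringExp
import Algebra.Properties.Semiring.Mult as SemiringMult
import Algebra.Properties.Semiring.Sum as SemiringSum
import Algebra.Solver.Ring as RingSolver
open import Algebra.Solver.Ring.AlmostCommutativeRing using (_-Raw-AlmostCommutative⟶_; fromCommutativeSemiring)
open import Data.Bool.Base using (Bool; true; false; if_then_else_)
open import Data.Bool.Properties using (xor-∧-commutativeRing)
open import Data.Fin.Base as Fin using (Fin; toℕ; punchIn)
open import Data.Fin.Permutation using (Permutation; permutation)
open import Data.Fin.Properties using (punchInᵢ≢i; suc-injective)
open import Data.Maybe.Base using (Maybe; just; nothing)
open import Data.Maybe.Relation.Binary.Pointwise as Pointwise using (just)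
import Data.Nat.Base as ℕ
open import Data.Nat.Base using (zero; z<s; s<s; s<s⁻¹)
open import Data.Nat.Combinatorics using (_C_; nCk+nC[k+1]≡[n+1]C[k+1]; k>n⇒nCk≡0)
import Data.Nat.Properties as ℕ
open import Data.Nat.Tactic.RingSolver using (solve-∀)
open import Data.Product.Base using (∃; _,_; proj₁; proj₂)
open import Data.Sum.Base using (_⊎_; inj₁; inj₂)
open import Data.Vec.Base using (Vec; []; _∷_)
open import Function.Base using (case_of_)
open import Function.Bundles using (Inverse)
open import Relation.Binary.PropositionalEquality as ≡ using (_≡_; _≢_)
open import Relation.Nullary.Decidable using (yes; no)
open import Relation.Nullary.Negation using (contradiction)
open import Relation.Unary using (_⊆_)

-- The field comes with nothing but an enumeration by 2^n elements, so 1 + 1 = 0 and x^q = x for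
-- nonzero x both rest on permutations of that enumeration. The coefficients of D_m are defined by a
-- quotient, which hides the recurrence; `lucasCoeff` (the coefficients of the Lucas polynomials,
-- with value 2 in degree 0) obeys it by construction and is identified with the quotient by
-- clearing the denominator. Inverses travel as pairs with x * u = 1, because `inv` also depends on
-- a proof that x is nonzero. The bound n > 2 decides whether w exists: for q = 4 every nonzero α
-- has α⁻¹ = α², so the traces of α and α⁻¹ always agree. For larger n some y is not a root of y⁴ +
-- y, and w is one of ay, a(y + 1), a(y² + y) for a suitable a.

-- Integer coefficients of the Dickson polynomials

lucasCoeff : ℕ → ℕ → ℕ
lucasCoeff zero          zero    = 2
lucasCoeff zero          (suc i) = 0
lucasCoeff (suc m)       zero    = 1
lucasCoeff (suc zero)    (suc i) = 0
lucasCoeff (suc (suc m)) (suc i) = lucasCoeff (suc m) (suc i) ℕ.+ lucasCoeff m i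

lucasCoeff-vanishes : ∀ m i → m ℕ.< 2 ℕ.* i → lucasCoeff m i ≡ 0
lucasCoeff-vanishes zero          (suc i) _ = ≡.refl
lucasCoeff-vanishes (suc zero)    (suc i) _ = ≡.refl
lucasCoeff-vanishes (suc (suc m)) (suc i) 2+m<2+2i = ≡.cong₂ ℕ._+_
  (lucasCoeff-vanishes (suc m) (suc i) (ℕ.<-trans (ℕ.n<1+n (suc m)) 2+m<2+2i))
  (lucasCoeff-vanishes m i (s<s⁻¹ (s<s⁻¹ (≡.subst (suc (suc m) ℕ.<_) (ℕ.*-suc 2 i) 2+m<2+2i))))

-- The quotient m/(m-i) * C(m-i, i) splits as C(m-i, i) + C(m-i-1, i-1), and this sum follows the
-- recurrence by Pascal's rule alone. Writing m = (i+1) + (d+1) avoids subtraction.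
lucasCoeff-binomial : ∀ d i → lucasCoeff (suc i ℕ.+ suc d) (suc i) ≡ (suc d C suc i) ℕ.+ (d C i)
lucasCoeff-binomial zero    zero    = ≡.refl
lucasCoeff-binomial zero    (suc i)
  rewrite k>n⇒nCk≡0 {1} {suc (suc i)} (s<s z<s) | k>n⇒nCk≡0 {0} {suc i} z<s =
  lucasCoeff-vanishes (suc (suc i) ℕ.+ 1) (suc (suc i))
    (ℕ.+-monoʳ-< (suc (suc i)) (s<s z<s))
lucasCoeff-binomial (suc d) zero
  rewrite ≡.sym (nCk+nC[k+1]≡[n+1]C[k+1] (suc d) 0) | lucasCoeff-binomial d zero =
  ≡.cong (ℕ._+ 1) (ℕ.+-comm (suc d C 1) 1)
lucasCoeff-binomial (suc d) (suc i) = begin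
  lucasCoeff (suc (i ℕ.+ suc (suc d))) (suc (suc i)) ℕ.+ lucasCoeff (i ℕ.+ suc (suc d)) (suc i)
    ≡⟨ ≡.cong (λ m → lucasCoeff (suc m) (suc (suc i)) ℕ.+ lucasCoeff m (suc i)) (ℕ.+-suc i (suc d)) ⟩
  lucasCoeff (suc (suc i) ℕ.+ suc d) (suc (suc i)) ℕ.+ lucasCoeff (suc i ℕ.+ suc d) (suc i)
    ≡⟨ ≡.cong₂ ℕ._+_ (lucasCoeff-binomial d (suc i)) (lucasCoeff-binomial d i) ⟩
  (suc d C suc (suc i)) ℕ.+ (d C suc i) ℕ.+ ((suc d C suc i) ℕ.+ (d C i))
    ≡⟨ rearrange (suc d C suc (suc i)) (d C suc i) (suc d C suc i) (d C i) ⟩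
  (suc d C suc i) ℕ.+ (suc d C suc (suc i)) ℕ.+ ((d C i) ℕ.+ (d C suc i))
    ≡⟨ ≡.cong₂ ℕ._+_ (nCk+nC[k+1]≡[n+1]C[k+1] (suc d) (suc i)) (nCk+nC[k+1]≡[n+1]C[k+1] d i) ⟩
  (suc (suc d) C suc (suc i)) ℕ.+ (suc d C suc i) ∎
  where
  open ≡.≡-Reasoning
  rearrange : ∀ a b c d → a ℕ.+ b ℕ.+ (c ℕ.+ d) ≡ c ℕ.+ a ℕ.+ (d ℕ.+ b)
  rearrange = solve-∀

-- Absorption, (i+1) * C(d+1, i+1) = (d+1) * C(d, i), merges the two binomials into one with factor
-- (i+1) + (d+1).
lucasCoeff-exact : ∀ d i → lucasCoeff (i ℕ.+ suc d) i ℕ.* suc d ≡ (i ℕ.+ suc d) ℕ.* (suc d C i)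
lucasCoeff-exact d zero    = ≡.trans (ℕ.*-identityˡ (suc d)) (≡.sym (ℕ.*-identityʳ (suc d)))
lucasCoeff-exact d (suc i) = begin
  lucasCoeff (suc i ℕ.+ suc d) (suc i) ℕ.* suc d
    ≡⟨ ≡.cong (ℕ._* suc d) (lucasCoeff-binomial d i) ⟩
  ((suc d C suc i) ℕ.+ (d C i)) ℕ.* suc d
    ≡⟨ expand (suc d) (suc d C suc i) (d C i) ⟩
  suc d ℕ.* (d C i) ℕ.+ suc d ℕ.* (suc d C suc i)
    ≡⟨ ≡.cong (ℕ._+ suc d ℕ.* (suc d C suc i)) ([k+1]*[n+1]C[k+1]≡[n+1]*nCk d i) ⟨
  suc i ℕ.* (suc d C suc i) ℕ.+ suc d ℕ.* (suc d C suc i)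
    ≡⟨ ℕ.*-distribʳ-+ (suc d C suc i) (suc i) (suc d) ⟨
  (suc i ℕ.+ suc d) ℕ.* (suc d C suc i) ∎
  where
  open ≡.≡-Reasoning
  expand : ∀ d a b → (a ℕ.+ b) ℕ.* d ≡ d ℕ.* b ℕ.+ d ℕ.* a
  expand = solve-∀

-- Both sides become m * C(m-i, i) after multiplication by the nonzero m - i.
dicksonCoeff≡lucasCoeff : ∀ m .{{_ : ℕ.NonZero m}} (i : Fin (suc ℕ.⌊ m /2⌋)) →
  dicksonCoeff m i ≡ lucasCoeff m (toℕ i)
dicksonCoeff≡lucasCoeff m i =
  ℕ.*-cancelʳ-≡ _ _ (m ℕ.∸ toℕ i) {{m∸i-nonZero m i}}
    (≡.trans (dicksonCoeff-exact m i) (≡.sym exact))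
  where
  d = m ℕ.∸ toℕ i
  suc-pred-d : suc (ℕ.pred d) ≡ d
  suc-pred-d = ℕ.suc-pred d {{m∸i-nonZero m i}}
  i+d≡m : toℕ i ℕ.+ d ≡ m
  i+d≡m = ℕ.m+[n∸m]≡n {toℕ i} {m} (ℕ.<⇒≤ (ℕ.m∸n≢0⇒n<m (ℕ.≢-nonZero⁻¹ d {{m∸i-nonZero m i}})))
  exact : lucasCoeff m (toℕ i) ℕ.* d ≡ m ℕ.* (d C toℕ i)
  exact = ≡.subst₂ (λ m′ d′ → lucasCoeff m′ (toℕ i) ℕ.* d′ ≡ m′ ℕ.* (d′ C toℕ i))
    (≡.trans (≡.cong (toℕ i ℕ.+_) suc-pred-d) i+d≡m) suc-pred-d
    (lucasCoeff-exact (ℕ.pred d) (toℕ i))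

-- Commutative rings of characteristic two

HasCharacteristicTwo : ∀ {c ℓ} → CommutativeRing c ℓ → Set ℓ
HasCharacteristicTwo R = 1# + 1# ≈ 0#
  where
  open CommutativeRing R

module CharacteristicTwo {c ℓ} (R : CommutativeRing c ℓ) (1+1≈0 : HasCharacteristicTwo R) where

  open CommutativeRing R hiding (zero)
  open RingProperties ring using (+-inverseʳ-unique)
  open SemiringExp semiring using (^-congˡ; ^-congʳ; ^-assocʳ) renaming (_^_ to _↑_)
  open SemiringMult semiring using (×-homo-+) renaming (_×_ to _·_)
  open SemiringSum semiring using (sum; sum-cong-≋; sum-replicate-zero; ∑-distrib-+; *-distribˡ-sum)
  open import Relation.Binary.Reasoning.Setoid setoid

  -- Coefficients in 𝔽₂ make the ring solver decide identities modulo 2.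
  fromBool : Bool → Carrier
  fromBool b = if b then 1# else 0#

  fromBool-homo : CommutativeRing.rawRing xor-∧-commutativeRing -Raw-AlmostCommutative⟶ fromCommutativeSemiring commutativeSemiring
  fromBool-homo = record
    { ⟦_⟧    = fromBool
    ; +-homo = λ where
        false b     → sym (+-identityˡ (fromBool b))
        true  false → sym (+-identityʳ 1#)
        true  true  → sym 1+1≈0
    ; *-homo = λ where
        false b → sym (zeroˡ (fromBool b))
        true  b → sym (*-identityˡ (fromBool b))
    ; -‿homo = λ _ → refl
    ; 0-homo = refl
    ; 1-homo = refl
    }

  fromBool-≟ : ∀ a b → Maybe (fromBool a ≈ fromBool b)
  fromBool-≟ false false = just refl
  fromBool-≟ true  true  = just refl
  fromBool-≟ _     _     = nothing

  open RingSolver _ _ fromBool-homo fromBool-≟ public using (solve; _:=_; _:+_; _:*_; con)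

  x+x≈0 : ∀ x → x + x ≈ 0#
  x+x≈0 = solve 1 (λ x → x :+ x := con false) refl

  x+y≈0⇒x≈y : ∀ {x y} → x + y ≈ 0# → x ≈ y
  x+y≈0⇒x≈y {x} {y} x+y≈0 = begin
    x            ≈⟨ solve 2 (λ x y → x := x :+ y :+ y) refl x y ⟩
    x + y + y    ≈⟨ +-congʳ x+y≈0 ⟩
    0# + y       ≈⟨ +-identityˡ y ⟩
    y            ∎

  -1≈1 : - 1# ≈ 1#
  -1≈1 = sym (+-inverseʳ-unique 1# 1# 1+1≈0)

  -- Frobenius powers, truncated traces and Hilbert 90

  frob : ℕ → Carrier → Carrier
  frob zero    x = x
  frob (suc k) x = frob k (x * x)

  -- The truncated trace x + x² + ... + x^(2^(k-1)) is kept for every k, so that its identities go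
  -- by induction in any ring of characteristic 2; only at k = n is it the trace of the field.
  tr : ℕ → Carrier → Carrier
  tr zero    x = 0#
  tr (suc k) x = x + tr k (x * x)

  frob-cong : ∀ k {x y} → x ≈ y → frob k x ≈ frob k y
  frob-cong zero    x≈y = x≈y
  frob-cong (suc k) x≈y = frob-cong k (*-cong x≈y x≈y)

  frob-square : ∀ k x → frob k (x * x) ≈ frob k x * frob k x
  frob-square zero    x = refl
  frob-square (suc k) x = frob-square k (x * x)

  frob-inverse : ∀ k {x y} → x * y ≈ 1# → frob k x * frob k y ≈ 1#
  frob-inverse zero    xy≈1 = xy≈1
  frob-inverse (suc k) {x} {y} xy≈1 = frob-inverse k (begin
    x * x * (y * y)    ≈⟨ solve 2 (λ x y → x :* x :* (y :* y) := x :* y :* (x :* y)) refl x y ⟩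
    x * y * (x * y)    ≈⟨ *-cong xy≈1 xy≈1 ⟩
    1# * 1#            ≈⟨ *-identityˡ 1# ⟩
    1#                 ∎)

  x^2^[1+k]≈[xx]^2^k : ∀ k x → x ↑ (2 ℕ.^ suc k) ≈ (x * x) ↑ (2 ℕ.^ k)
  x^2^[1+k]≈[xx]^2^k k x = trans (sym (^-assocʳ x 2 (2 ℕ.^ k))) (^-congˡ (2 ℕ.^ k) (*-congˡ (*-identityʳ x)))

  x^2^k≈frob : ∀ k x → x ↑ (2 ℕ.^ k) ≈ frob k x
  x^2^k≈frob zero    x = *-identityʳ x
  x^2^k≈frob (suc k) x = trans (x^2^[1+k]≈[xx]^2^k k x) (x^2^k≈frob k (x * x))

  ∑x^2^j≈tr : ∀ k x → sum {k} (λ j → x ↑ (2 ℕ.^ toℕ j)) ≈ tr k x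
  ∑x^2^j≈tr zero    x = refl
  ∑x^2^j≈tr (suc k) x = +-cong (*-identityʳ x)
    (trans (sum-cong-≋ {k} (λ j → x^2^[1+k]≈[xx]^2^k (toℕ j) x)) (∑x^2^j≈tr k (x * x)))

  tr-cong : ∀ k {x y} → x ≈ y → tr k x ≈ tr k y
  tr-cong zero    x≈y = refl
  tr-cong (suc k) x≈y = +-cong x≈y (tr-cong k (*-cong x≈y x≈y))

  tr-+ : ∀ k x y → tr k (x + y) ≈ tr k x + tr k y
  tr-+ zero    x y = sym (+-identityˡ 0#)
  tr-+ (suc k) x y = begin
    x + y + tr k ((x + y) * (x + y))
      ≈⟨ +-congˡ (tr-cong k (solve 2 (λ x y → (x :+ y) :* (x :+ y) := x :* x :+ y :* y) refl x y)) ⟩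
    x + y + tr k (x * x + y * y)
      ≈⟨ +-congˡ (tr-+ k (x * x) (y * y)) ⟩
    x + y + (tr k (x * x) + tr k (y * y))
      ≈⟨ solve 4 (λ x y s t → x :+ y :+ (s :+ t) := (x :+ s) :+ (y :+ t)) refl x y _ _ ⟩
    (x + tr k (x * x)) + (y + tr k (y * y)) ∎

  tr-square : ∀ k x → tr k (x * x) ≈ tr k x * tr k x
  tr-square zero    x = sym (zeroˡ 0#)
  tr-square (suc k) x = begin
    x * x + tr k (x * x * (x * x))
      ≈⟨ +-congˡ (tr-square k (x * x)) ⟩
    x * x + tr k (x * x) * tr k (x * x)
      ≈⟨ solve 2 (λ x t → x :* x :+ t :* t := (x :+ t) :* (x :+ t)) refl x _ ⟩
    (x + tr k (x * x)) * (x + tr k (x * x)) ∎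

  tr-suc : ∀ k x → tr (suc k) x ≈ tr k x + frob k x
  tr-suc zero    x = +-comm x 0#
  tr-suc (suc k) x = trans (+-congˡ (tr-suc k (x * x))) (sym (+-assoc _ _ _))

  -- Splitting off the first or the last term of `tr (suc k) x` gives two expressions to compare. In
  -- the field the right side vanishes at k = n, which makes traces idempotent.
  tr²+tr≈frob+id : ∀ k x → tr k x * tr k x + tr k x ≈ frob k x + x
  tr²+tr≈frob+id k x = begin
    tr k x * tr k x + tr k x                  ≈⟨ +-congʳ (tr-square k x) ⟨
    tr k (x * x) + tr k x                     ≈⟨ solve 3 (λ x s t → s :+ t := x :+ s :+ t :+ x) refl x _ _ ⟩
    tr (suc k) x + tr k x + x                 ≈⟨ +-congʳ (+-congʳ (tr-suc k x)) ⟩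
    tr k x + frob k x + tr k x + x            ≈⟨ solve 3 (λ x s t → t :+ s :+ t :+ x := s :+ x) refl x _ _ ⟩
    frob k x + x                              ∎

  -- The truncations of the classical Hilbert 90 solution
  -- ∑ⱼ (a + a² + ⋯ + a^2ʲ⁻¹) b^2ʲ, which solves y² + y = a once tr a = 0 and tr b = 1.
  hilbert90 : ℕ → Carrier → Carrier → Carrier
  hilbert90 zero    a b = 0#
  hilbert90 (suc k) a b = hilbert90 k a b + tr k a * frob k b

  -- The sum telescopes because tr_j(a)² = tr_(j+1)(a) + a. What is left is a boundary term, which
  -- vanishes when tr a = 0, and a multiple of a, which is a itself when tr b = 1.
  hilbert90-y²+y : ∀ k a b → let y = hilbert90 k a b in
    y * y + y ≈ tr k a * frob k b + a * (tr k b * tr k b)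
  hilbert90-y²+y zero    a b = solve 2 (λ a b →
    con false :* con false :+ con false := con false :* b :+ a :* (con false :* con false)) refl a b
  hilbert90-y²+y (suc k) a b = begin
    (y + A * f) * (y + A * f) + (y + A * f)
      ≈⟨ solve 3 (λ y A f → (y :+ A :* f) :* (y :+ A :* f) :+ (y :+ A :* f) :=
           (y :* y :+ y) :+ A :* A :* (f :* f) :+ A :* f) refl y A f ⟩
    (y * y + y) + A * A * (f * f) + A * f
      ≈⟨ +-congʳ (+-congʳ (hilbert90-y²+y k a b)) ⟩
    (A * f + a * (t * t)) + A * A * (f * f) + A * f
      ≈⟨ solve 4 (λ a A f t → (A :* f :+ a :* (t :* t)) :+ A :* A :* (f :* f) :+ A :* f :=
           (a :+ A :* A) :* (f :* f) :+ a :* ((t :+ f) :* (t :+ f))) refl a A f t ⟩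
    (a + A * A) * (f * f) + a * ((t + f) * (t + f))
      ≈⟨ +-cong (*-cong (+-congˡ (tr-square k a)) (frob-square k b))
                (*-congˡ (*-cong (tr-suc k b) (tr-suc k b))) ⟨
    tr (suc k) a * frob (suc k) b + a * (tr (suc k) b * tr (suc k) b) ∎
    where
    y = hilbert90 k a b
    A = tr k a
    f = frob k b
    t = tr k b

  -- Dickson polynomials modulo 2 by recurrence

  -- Signs disappear modulo 2, and the initial value D_0 = 2 becomes 0.
  dickson : ℕ → Carrier → Carrier
  dickson zero          x = 0#
  dickson (suc zero)    x = x
  dickson (suc (suc m)) x = x * dickson (suc m) x + dickson m x

  -- The step from (a, b) to (b, xb + a) preserves the form b² + xab + a², which therefore keeps its
  -- initial value. This invariant stands in for the product formula D_i D_j = D_(i+j) + D_(i-j),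
  -- usually proved by adjoining t with x = t + t⁻¹.
  dickson-quadratic : ∀ m x → let a = dickson m x; b = dickson (suc m) x in
    b * b + x * (a * b) + a * a ≈ x * x
  dickson-quadratic zero x =
    solve 1 (λ x → x :* x :+ x :* (con false :* x) :+ con false :* con false := x :* x) refl x
  dickson-quadratic (suc m) x = trans
    (solve 3 (λ x a b → (x :* b :+ a) :* (x :* b :+ a) :+ x :* (b :* (x :* b :+ a)) :+ b :* b :=
       b :* b :+ x :* (a :* b) :+ a :* a) refl x (dickson m x) (dickson (suc m) x))
    (dickson-quadratic m x)

  -- The parities are proved as a pair because the recurrence for either index calls for the other.
  dickson-double : ∀ m x → let a = dickson m x; b = dickson (suc m) x in
    dickson (2 ℕ.* m) x ≈ a * a × dickson (suc (2 ℕ.* m)) x ≈ a * b + x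
  dickson-double zero x = sym (zeroˡ 0#) , solve 1 (λ x → x := con false :* x :+ x) refl x
  dickson-double (suc m) x =
    ≡.subst (λ k → dickson k x ≈ b * b × dickson (suc k) x ≈ b * (x * b + a) + x)
      (≡.sym (ℕ.*-suc 2 m)) (even , odd)
    where
    a = dickson m x
    b = dickson (suc m) x
    even : x * dickson (suc (2 ℕ.* m)) x + dickson (2 ℕ.* m) x ≈ b * b
    even = begin
      x * dickson (suc (2 ℕ.* m)) x + dickson (2 ℕ.* m) x
        ≈⟨ +-cong (*-congˡ (proj₂ (dickson-double m x))) (proj₁ (dickson-double m x)) ⟩
      x * (a * b + x) + a * a
        ≈⟨ solve 3 (λ x a b → x :* (a :* b :+ x) :+ a :* a :=
             b :* b :+ (b :* b :+ x :* (a :* b) :+ a :* a) :+ x :* x) refl x a b ⟩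
      b * b + (b * b + x * (a * b) + a * a) + x * x
        ≈⟨ +-congʳ (+-congˡ (dickson-quadratic m x)) ⟩
      b * b + x * x + x * x
        ≈⟨ solve 2 (λ x b → b :* b :+ x :* x :+ x :* x := b :* b) refl x b ⟩
      b * b ∎
    odd : x * (x * dickson (suc (2 ℕ.* m)) x + dickson (2 ℕ.* m) x) + dickson (suc (2 ℕ.* m)) x
          ≈ b * (x * b + a) + x
    odd = begin
      x * (x * dickson (suc (2 ℕ.* m)) x + dickson (2 ℕ.* m) x) + dickson (suc (2 ℕ.* m)) x
        ≈⟨ +-cong (*-congˡ even) (proj₂ (dickson-double m x)) ⟩
      x * (b * b) + (a * b + x)
        ≈⟨ solve 3 (λ x a b → x :* (b :* b) :+ (a :* b :+ x) := b :* (x :* b :+ a) :+ x) refl x a b ⟩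
      b * (x * b + a) + x ∎

  dickson-2^k : ∀ k x → dickson (2 ℕ.^ k) x ≈ frob k x
  dickson-2^k zero    x = refl
  dickson-2^k (suc k) x = begin
    dickson (2 ℕ.* 2 ℕ.^ k) x                        ≈⟨ proj₁ (dickson-double (2 ℕ.^ k) x) ⟩
    dickson (2 ℕ.^ k) x * dickson (2 ℕ.^ k) x        ≈⟨ *-cong (dickson-2^k k x) (dickson-2^k k x) ⟩
    frob k x * frob k x                              ≈⟨ frob-square k x ⟨
    frob k (x * x)                                   ∎

  -- Passing from index 1 + 2^k to 1 + 2^(k+1) multiplies by x^(2^k) and adds x. With g =
  -- x^(2^(k+1)) and h = u^(2^(k+1)) that x equals x * g * h, and h is the next term of the trace.
  -- The trace is that of u² because it starts with D_3 = x³(1 + u²).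
  dickson-1+2^k : ∀ k {x u} → x * u ≈ 1# →
    dickson (suc (2 ℕ.^ k)) x ≈ x * frob k x * (1# + tr k (u * u))
  dickson-1+2^k zero    {x} {u} xu≈1 = solve 1 (λ x →
    x :* x :+ con false := x :* x :* (con true :+ con false)) refl x
  dickson-1+2^k (suc k) {x} {u} xu≈1 = begin
    dickson (suc (2 ℕ.* 2 ℕ.^ k)) x
      ≈⟨ proj₂ (dickson-double (2 ℕ.^ k) x) ⟩
    dickson (2 ℕ.^ k) x * dickson (suc (2 ℕ.^ k)) x + x
      ≈⟨ +-congʳ (*-cong (dickson-2^k k x) (dickson-1+2^k k xu≈1)) ⟩
    f * (x * f * (1# + t)) + x
      ≈⟨ solve 3 (λ x f t → f :* (x :* f :* (con true :+ t)) :+ x :=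
           x :* (f :* f) :* (con true :+ t) :+ x :* con true) refl x f t ⟩
    x * (f * f) * (1# + t) + x * 1#
      ≈⟨ +-cong (*-congʳ (*-congˡ (frob-square k x))) (*-congˡ (frob-inverse (suc k) xu≈1)) ⟨
    x * g * (1# + t) + x * (g * h)
      ≈⟨ solve 4 (λ x g h t → x :* g :* (con true :+ t) :+ x :* (g :* h) :=
           x :* g :* (con true :+ (t :+ h))) refl x g h t ⟩
    x * g * (1# + (t + h))
      ≈⟨ *-congˡ (+-congˡ (tr-suc k (u * u))) ⟨
    x * g * (1# + tr (suc k) (u * u)) ∎
    where
    f = frob k x
    g = frob (suc k) x
    h = frob k (u * u)
    t = tr k (u * u)

  -- Agreement with the explicit sum

  dicksonTerm : ℕ → Carrier → ℕ → Carrier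
  dicksonTerm m x i = (lucasCoeff m i · 1#) * x ↑ (m ℕ.∸ 2 ℕ.* i)

  dicksonTerm-step : ∀ m x i →
    dicksonTerm (suc (suc m)) x (suc i) ≈ x * dicksonTerm (suc m) x (suc i) + dicksonTerm m x i
  dicksonTerm-step m x i = begin
    ((p ℕ.+ q) · 1#) * x ↑ (suc (suc m) ℕ.∸ 2 ℕ.* suc i)
      ≈⟨ *-cong (×-homo-+ 1# p q) (^-congʳ x (≡.cong (suc (suc m) ℕ.∸_) (ℕ.*-suc 2 i))) ⟩
    (p · 1# + q · 1#) * x ↑ (m ℕ.∸ 2 ℕ.* i)
      ≈⟨ distribʳ _ _ _ ⟩
    (p · 1#) * x ↑ (m ℕ.∸ 2 ℕ.* i) + dicksonTerm m x i
      ≈⟨ +-congʳ shift ⟩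
    x * dicksonTerm (suc m) x (suc i) + dicksonTerm m x i ∎
    where
    p = lucasCoeff (suc m) (suc i)
    q = lucasCoeff m i
    shift : (p · 1#) * x ↑ (m ℕ.∸ 2 ℕ.* i) ≈ x * ((p · 1#) * x ↑ (suc m ℕ.∸ 2 ℕ.* suc i))
    shift with 2 ℕ.* i ℕ.<? m
    ... | yes 2i<m = begin
      (p · 1#) * x ↑ (m ℕ.∸ 2 ℕ.* i)
        ≈⟨ *-congˡ (^-congʳ x exponent) ⟩
      (p · 1#) * (x * x ↑ (suc m ℕ.∸ 2 ℕ.* suc i))
        ≈⟨ solve 3 (λ p x y → p :* (x :* y) := x :* (p :* y)) refl _ x _ ⟩
      x * ((p · 1#) * x ↑ (suc m ℕ.∸ 2 ℕ.* suc i)) ∎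
      where
      exponent : m ℕ.∸ 2 ℕ.* i ≡ suc (suc m ℕ.∸ 2 ℕ.* suc i)
      exponent = ≡.trans (ℕ.+-∸-assoc 1 2i<m) (≡.cong (λ j → suc (suc m ℕ.∸ j)) (≡.sym (ℕ.*-suc 2 i)))
    -- Here truncation stops the exponents from differing by one, but the coefficient is zero
    -- because 2(i+1) exceeds m+1.
    ... | no 2i≮m rewrite lucasCoeff-vanishes (suc m) (suc i)
            (≡.subst (suc m ℕ.<_) (≡.sym (ℕ.*-suc 2 i)) (s<s (s<s (ℕ.≮⇒≥ 2i≮m)))) =
      solve 3 (λ x y z → con false :* y := x :* (con false :* z)) refl x _ _

  -- The cutoff K is left free because terms past m/2 vanish, and the step to m + 2 needs cutoff K +
  -- 1 for m + 1 but K for m, whose summands are shifted by one.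
  dickson≈∑ : ∀ m x K → m ℕ.< 2 ℕ.* K → dickson m x ≈ sum {K} (λ i → dicksonTerm m x (toℕ i))
  dickson≈∑ zero x (suc K) _ = sym (begin
    (1# + (1# + 0#)) * 1# + sum {K} (λ i → 0# * x ↑ 0)
      ≈⟨ +-congˡ (trans (sum-cong-≋ {K} (λ i → zeroˡ _)) (sum-replicate-zero K)) ⟩
    (1# + (1# + 0#)) * 1# + 0#
      ≈⟨ solve 0 ((con true :+ (con true :+ con false)) :* con true :+ con false := con false) refl ⟩
    0# ∎)
  dickson≈∑ (suc zero) x (suc K) _ = sym (begin
    (1# + 0#) * (x * 1#) + sum {K} (λ i → 0# * x ↑ (1 ℕ.∸ 2 ℕ.* suc (toℕ i)))
      ≈⟨ +-congˡ (trans (sum-cong-≋ {K} (λ i → zeroˡ _)) (sum-replicate-zero K)) ⟩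
    (1# + 0#) * (x * 1#) + 0#
      ≈⟨ solve 1 (λ x → (con true :+ con false) :* (x :* con true) :+ con false := x) refl x ⟩
    x ∎)
  dickson≈∑ (suc (suc m)) x (suc K) 2+m<2+2K = begin
    x * dickson (suc m) x + dickson m x
      ≈⟨ +-cong (*-congˡ (dickson≈∑ (suc m) x (suc K) (ℕ.<-trans (ℕ.n<1+n (suc m)) 2+m<2+2K)))
                (dickson≈∑ m x K (s<s⁻¹ (s<s⁻¹ (≡.subst (suc (suc m) ℕ.<_) (ℕ.*-suc 2 K) 2+m<2+2K)))) ⟩
    x * ((1# + 0#) * x ↑ suc m + sum {K} s) + sum {K} t
      ≈⟨ solve 5 (λ x y p s t → x :* (p :* y :+ s) :+ t := p :* (x :* y) :+ (x :* s :+ t)) refl x _ _ _ _ ⟩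
    (1# + 0#) * x ↑ suc (suc m) + (x * sum {K} s + sum {K} t)
      ≈⟨ +-congˡ (+-congʳ (*-distribˡ-sum {K} x s)) ⟩
    (1# + 0#) * x ↑ suc (suc m) + (sum {K} (λ i → x * s i) + sum {K} t)
      ≈⟨ +-congˡ (∑-distrib-+ {K} (λ i → x * s i) t) ⟨
    (1# + 0#) * x ↑ suc (suc m) + sum {K} (λ i → x * s i + t i)
      ≈⟨ +-congˡ (sum-cong-≋ {K} (λ i → dicksonTerm-step m x (toℕ i))) ⟨
    (1# + 0#) * x ↑ suc (suc m) + sum {K} (λ i → dicksonTerm (suc (suc m)) x (suc (toℕ i))) ∎
    where
    s t : Fin K → Carrier
    s i = dicksonTerm (suc m) x (suc (toℕ i))
    t i = dicksonTerm m x (toℕ i)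

  [-1]^k≈1 : ∀ k → (- 1#) ↑ k ≈ 1#
  [-1]^k≈1 zero    = refl
  [-1]^k≈1 (suc k) = trans (*-cong -1≈1 ([-1]^k≈1 k)) (*-identityˡ 1#)

  -- Monic polynomials and the trace polynomial

  -- A vector of length d holds the lower coefficients, constant term first,
  -- of a monic polynomial of degree d.
  Monic : ℕ → Set c
  Monic = Vec Carrier

  eval : ∀ {d} → Monic d → Carrier → Carrier
  eval []       x = 1#
  eval (a ∷ as) x = a + x * eval as x

  -- Synthetic division by x + r: the coefficients of the quotient are the Horner values at r, and
  -- the remainder `eval p r` is dropped.
  divide : ∀ {d} → Carrier → Monic (suc d) → Monic d
  divide r (a ∷ [])         = []
  divide r (a ∷ as@(_ ∷ _)) = eval as r ∷ divide r as

  eval-divide : ∀ {d} r (p : Monic (suc d)) x → eval p x + eval p r ≈ (x + r) * eval (divide r p) x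
  eval-divide r (a ∷ []) x =
    solve 3 (λ a x r → a :+ x :* con true :+ (a :+ r :* con true) := (x :+ r) :* con true) refl a x r
  eval-divide r (a ∷ as@(_ ∷ _)) x = begin
    a + x * eval as x + (a + r * eval as r)
      ≈⟨ solve 5 (λ a x r e f → a :+ x :* e :+ (a :+ r :* f) := (x :+ r) :* f :+ x :* (e :+ f))
           refl a x r (eval as x) (eval as r) ⟩
    (x + r) * eval as r + x * (eval as x + eval as r)
      ≈⟨ +-congˡ (*-congˡ (eval-divide r as x)) ⟩
    (x + r) * eval as r + x * ((x + r) * eval (divide r as) x)
      ≈⟨ solve 4 (λ x r f g → (x :+ r) :* f :+ x :* ((x :+ r) :* g) := (x :+ r) :* (f :+ x :* g))
           refl x r (eval as r) (eval (divide r as) x) ⟩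
    (x + r) * (eval as r + x * eval (divide r as) x) ∎

  square : ∀ {d} → Monic d → Monic (d ℕ.* 2)
  square []       = []
  square (a ∷ as) = a * a ∷ 0# ∷ square as

  eval-square : ∀ {d} (p : Monic d) x → eval (square p) x ≈ eval p x * eval p x
  eval-square []       x = sym (*-identityˡ 1#)
  eval-square (a ∷ as) x = begin
    a * a + x * (0# + x * eval (square as) x)
      ≈⟨ +-congˡ (*-congˡ (+-congˡ (*-congˡ (eval-square as x)))) ⟩
    a * a + x * (0# + x * (eval as x * eval as x))
      ≈⟨ solve 3 (λ a x e → a :* a :+ x :* (con false :+ x :* (e :* e)) := (a :+ x :* e) :* (a :+ x :* e))
           refl a x (eval as x) ⟩
    (a + x * eval as x) * (a + x * eval as x) ∎

  -- The degree 2^k of `tracePoly k` is kept in successor form so that the constant term can be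
  -- split off by matching.
  predTraceDegree : ℕ → ℕ
  predTraceDegree zero    = 0
  predTraceDegree (suc k) = suc (predTraceDegree k ℕ.* 2)

  1+predTraceDegree≡2^k : ∀ k → suc (predTraceDegree k) ≡ 2 ℕ.^ k
  1+predTraceDegree≡2^k zero    = ≡.refl
  1+predTraceDegree≡2^k (suc k) =
    ≡.trans (ℕ.*-comm (suc (predTraceDegree k)) 2) (≡.cong (2 ℕ.*_) (1+predTraceDegree≡2^k k))

  tracePoly : ∀ k → Monic (suc (predTraceDegree k))
  tracePoly zero = 0# ∷ []
  tracePoly (suc k) with tracePoly k
  -- Each trace is x plus the square of the previous one; x takes the linear place, where a square
  -- has coefficient 0.
  ... | a ∷ as = a * a ∷ 1# ∷ square as

  eval-tracePoly : ∀ k x → eval (tracePoly k) x ≈ tr (suc k) x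
  eval-tracePoly zero    x = solve 1 (λ x → con false :+ x :* con true := x :+ con false) refl x
  eval-tracePoly (suc k) x with tracePoly k | eval-tracePoly k x
  ... | a ∷ as | ih = begin
    a * a + x * (1# + x * eval (square as) x)
      ≈⟨ +-congˡ (*-congˡ (+-congˡ (*-congˡ (eval-square as x)))) ⟩
    a * a + x * (1# + x * (eval as x * eval as x))
      ≈⟨ solve 3 (λ a x e → a :* a :+ x :* (con true :+ x :* (e :* e)) := x :+ (a :+ x :* e) :* (a :+ x :* e))
           refl a x (eval as x) ⟩
    x + (a + x * eval as x) * (a + x * eval as x)
      ≈⟨ +-congˡ (*-cong ih ih) ⟩
    x + tr (suc k) x * tr (suc k) x
      ≈⟨ +-congˡ (tr-square (suc k) x) ⟨
    tr (suc (suc k)) x ∎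

n<2*[1+⌊n/2⌋] : ∀ n → n ℕ.< 2 ℕ.* suc ℕ.⌊ n /2⌋
n<2*[1+⌊n/2⌋] zero          = z<s
n<2*[1+⌊n/2⌋] (suc zero)    = s<s z<s
n<2*[1+⌊n/2⌋] (suc (suc n)) =
  ≡.subst (suc (suc n) ℕ.<_) (≡.sym (ℕ.*-suc 2 (suc ℕ.⌊ n /2⌋))) (s<s (s<s (n<2*[1+⌊n/2⌋] n)))

module _ {a ℓ} (M : CommutativeMonoid a ℓ) where
  open CommutativeMonoid M
  open CommutativeMonoidSum M using (sum; sum-remove; sum-cong-≋; sum-replicate-zero)

  sum-single : ∀ {n} (i : Fin n) (t : Fin n → Carrier) → (∀ j → j ≢ i → t j ≈ ε) → sum t ≈ t i
  sum-single {suc n} i t t≈ε = trans (sum-remove {i = i} t)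
    (trans (∙-congˡ (trans (sum-cong-≋ {n} (λ j → t≈ε (punchIn i j) (punchInᵢ≢i i j))) (sum-replicate-zero n)))
           (identityʳ (t i)))

-- Finite fields: characteristic, x^q = x, arrows of the graph

module Field {c ℓ q} (F : FiniteField c ℓ q) where
  open FiniteField F
  open Inverse enumeration using (to; from; to-cong; strictlyInverseˡ; strictlyInverseʳ)
  open SemiringExp semiring using () renaming (_^_ to _↑_)
  open SemiringMult semiring using (×1-homo-*) renaming (_×_ to _·_)
  module ∑ = CommutativeMonoidSum +-commutativeMonoid
  module ∏ = CommutativeMonoidSum *-commutativeMonoid
  open RingProperties ring using (+-identityˡ-unique)
  open import Relation.Binary.Reasoning.Setoid setoid

  from-injective : ∀ {i j} → from i ≈ from j → i ≡ j
  from-injective {i} {j} eq =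
    ≡.trans (≡.sym (strictlyInverseˡ i)) (≡.trans (to-cong eq) (strictlyInverseˡ j))

  cancelˡ : ∀ {x y} → x ≉ 0# → x ⊗ y ≈ 0# → y ≈ 0#
  cancelˡ {x} {y} x≉0 xy≈0 with invertible x x≉0
  ... | x⁻¹ , x⁻¹x≈1 , _ = begin
    y                ≈⟨ *-identityˡ y ⟨
    1# ⊗ y           ≈⟨ *-congʳ x⁻¹x≈1 ⟨
    x⁻¹ ⊗ x ⊗ y      ≈⟨ *-assoc _ _ _ ⟩
    x⁻¹ ⊗ (x ⊗ y)    ≈⟨ *-congˡ xy≈0 ⟩
    x⁻¹ ⊗ 0#         ≈⟨ zeroʳ x⁻¹ ⟩
    0#               ∎

  ⊗-nonzero : ∀ {x y} → x ≉ 0# → y ≉ 0# → x ⊗ y ≉ 0#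
  ⊗-nonzero x≉0 y≉0 xy≈0 = y≉0 (cancelˡ x≉0 xy≈0)

  xu≈1⇒x≉0 : ∀ {x u} → x ⊗ u ≈ 1# → x ≉ 0#
  xu≈1⇒x≉0 {x} {u} xu≈1 x≈0 = 0≉1 (trans (sym (zeroˡ u)) (trans (*-congʳ (sym x≈0)) xu≈1))

  inverse-unique : ∀ {x u v} → x ⊗ u ≈ 1# → x ⊗ v ≈ 1# → u ≈ v
  inverse-unique {x} {u} {v} xu≈1 xv≈1 = begin
    u                ≈⟨ *-identityʳ u ⟨
    u ⊗ 1#           ≈⟨ *-congˡ xv≈1 ⟨
    u ⊗ (x ⊗ v)      ≈⟨ *-assoc _ _ _ ⟨
    u ⊗ x ⊗ v        ≈⟨ *-congʳ (trans (*-comm u x) xu≈1) ⟩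
    1# ⊗ v           ≈⟨ *-identityˡ v ⟩
    v                ∎

  inv-inverseʳ : ∀ x x≉0 → x ⊗ inv x x≉0 ≈ 1#
  inv-inverseʳ x x≉0 = proj₂ (proj₂ (invertible x x≉0))

  reindexing : (f g : Carrier → Carrier) → (∀ {x y} → x ≈ y → f x ≈ f y) → (∀ {x y} → x ≈ y → g x ≈ g y) →
    (∀ x → f (g x) ≈ x) → (∀ x → g (f x) ≈ x) → Permutation q q
  reindexing f g f-cong g-cong f∘g g∘f = permutation (λ i → to (f (from i))) (λ i → to (g (from i)))
    (λ i → ≡.trans (to-cong (trans (f-cong (strictlyInverseʳ _)) (f∘g (from i)))) (strictlyInverseˡ i))
    (λ i → ≡.trans (to-cong (trans (g-cong (strictlyInverseʳ _)) (g∘f (from i)))) (strictlyInverseˡ i))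

  -- Adding 1 permutes the field, so the sum S of all elements satisfies q * 1 + S = S.
  q·1≈0 : q · 1# ≈ 0#
  q·1≈0 = +-identityˡ-unique (q · 1#) (∑.sum from) (begin
    q · 1# ⊕ ∑.sum from                          ≈⟨ +-congʳ (∑.sum-replicate q) ⟨
    ∑.sum {q} (λ _ → 1#) ⊕ ∑.sum from            ≈⟨ ∑.∑-distrib-+ {q} (λ _ → 1#) from ⟨
    ∑.sum (λ i → 1# ⊕ from i)                    ≈⟨ ∑.sum-cong-≋ {q} (λ i → strictlyInverseʳ _) ⟨
    ∑.sum (λ i → from (to (1# ⊕ from i)))        ≈⟨ ∑.sum-permute from shift ⟨
    ∑.sum from                                   ∎)
    where
    shift : Permutation q q
    shift = reindexing (1# ⊕_) (⊖ 1# ⊕_) +-congˡ +-congˡ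
      (λ x → trans (sym (+-assoc _ _ _)) (trans (+-congʳ (-‿inverseʳ 1#)) (+-identityˡ x)))
      (λ x → trans (sym (+-assoc _ _ _)) (trans (+-congʳ (-‿inverseˡ 1#)) (+-identityˡ x)))

  -- 2^k * 1 is a product of k factors 1 + 1, and a field has no zero divisors.
  2^k·1≈0⇒1+1≈0 : ∀ k → (2 ℕ.^ k) · 1# ≈ 0# → 1# ⊕ 1# ≈ 0#
  2^k·1≈0⇒1+1≈0 zero    1≈0 = contradiction (sym (trans (sym (+-identityʳ 1#)) 1≈0)) 0≉1
  2^k·1≈0⇒1+1≈0 (suc k) 2^[1+k]≈0 with (1# ⊕ 1#) ≟ 0#
  ... | yes 1+1≈0 = 1+1≈0
  ... | no  1+1≉0 = 2^k·1≈0⇒1+1≈0 k (cancelˡ 1+1≉0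
    (trans (*-congʳ (+-congˡ (sym (+-identityʳ 1#)))) (trans (sym (×1-homo-* 2 (2 ℕ.^ k))) 2^[1+k]≈0)))

  nonzeroPart : Carrier → Carrier
  nonzeroPart x with x ≟ 0#
  ... | yes _ = 1#
  ... | no  _ = x

  nonzeroPart-zero : ∀ {x} → x ≈ 0# → nonzeroPart x ≈ 1#
  nonzeroPart-zero {x} x≈0 with x ≟ 0#
  ... | yes _   = refl
  ... | no  x≉0 = contradiction x≈0 x≉0

  nonzeroPart-nonzero : ∀ {x} → x ≉ 0# → nonzeroPart x ≈ x
  nonzeroPart-nonzero {x} x≉0 with x ≟ 0#
  ... | yes x≈0 = contradiction x≈0 x≉0
  ... | no  _   = refl

  nonzeroPart-cong : ∀ {x y} → x ≈ y → nonzeroPart x ≈ nonzeroPart y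
  nonzeroPart-cong {x} {y} x≈y with x ≟ 0#
  ... | yes x≈0 = sym (nonzeroPart-zero (trans (sym x≈y) x≈0))
  ... | no  x≉0 = trans x≈y (sym (nonzeroPart-nonzero (λ y≈0 → x≉0 (trans x≈y y≈0))))

  nonzeroPart≉0 : ∀ x → nonzeroPart x ≉ 0#
  nonzeroPart≉0 x with x ≟ 0#
  ... | yes _   = λ 1≈0 → 0≉1 (sym 1≈0)
  ... | no  x≉0 = x≉0

  ∏≉0 : ∀ {m} (t : Fin m → Carrier) → (∀ i → t i ≉ 0#) → ∏.sum t ≉ 0#
  ∏≉0 {zero}  t t≉0 1≈0 = 0≉1 (sym 1≈0)
  ∏≉0 {suc m} t t≉0 = ⊗-nonzero (t≉0 Fin.zero) (∏≉0 (λ i → t (Fin.suc i)) (λ i → t≉0 (Fin.suc i)))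

  -- Multiplication by a permutes the nonzero elements.  To multiply over all
  -- of F instead, replace 0 by 1 and let `atZero` account for the extra factor a.
  fermat : ∀ {a} → a ≉ 0# → a ↑ q ≈ a
  fermat {a} a≉0 = a^q≈a
    where
    a⁻¹ = inv a a≉0
    aa⁻¹≈1 = inv-inverseʳ a a≉0
    a⁻¹a≈1 = trans (*-comm a⁻¹ a) aa⁻¹≈1

    scale : Permutation q q
    scale = reindexing (a ⊗_) (a⁻¹ ⊗_) *-congˡ *-congˡ
      (λ x → trans (sym (*-assoc _ _ _)) (trans (*-congʳ aa⁻¹≈1) (*-identityˡ x)))
      (λ x → trans (sym (*-assoc _ _ _)) (trans (*-congʳ a⁻¹a≈1) (*-identityˡ x)))

    atZero : Carrier → Carrier
    atZero x with x ≟ 0#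
    ... | yes _ = a
    ... | no  _ = 1#

    atZero-zero : ∀ {x} → x ≈ 0# → atZero x ≈ a
    atZero-zero {x} x≈0 with x ≟ 0#
    ... | yes _   = refl
    ... | no  x≉0 = contradiction x≈0 x≉0

    atZero-nonzero : ∀ {x} → x ≉ 0# → atZero x ≈ 1#
    atZero-nonzero {x} x≉0 with x ≟ 0#
    ... | yes x≈0 = contradiction x≈0 x≉0
    ... | no  _   = refl

    a⊗nonzeroPart : ∀ x → a ⊗ nonzeroPart x ≈ atZero x ⊗ nonzeroPart (a ⊗ x)
    a⊗nonzeroPart x = case x ≟ 0# of λ where
      (yes x≈0) → *-cong (sym (atZero-zero x≈0))
        (trans (nonzeroPart-zero x≈0) (sym (nonzeroPart-zero (trans (*-congˡ x≈0) (zeroʳ a)))))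
      (no x≉0) → begin
        a ⊗ nonzeroPart x                  ≈⟨ *-congˡ (nonzeroPart-nonzero x≉0) ⟩
        a ⊗ x                              ≈⟨ nonzeroPart-nonzero (⊗-nonzero a≉0 x≉0) ⟨
        nonzeroPart (a ⊗ x)                ≈⟨ *-identityˡ _ ⟨
        1# ⊗ nonzeroPart (a ⊗ x)           ≈⟨ *-congʳ (atZero-nonzero x≉0) ⟨
        atZero x ⊗ nonzeroPart (a ⊗ x)     ∎

    P = ∏.sum (λ i → nonzeroPart (from i))
    P≉0 = ∏≉0 (λ i → nonzeroPart (from i)) (λ i → nonzeroPart≉0 (from i))

    ∏atZero : ∏.sum (λ i → atZero (from i)) ≈ a
    ∏atZero = trans
      (sum-single *-commutativeMonoid (to 0#) (λ i → atZero (from i))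
        (λ j j≢to0 → atZero-nonzero (λ fromj≈0 → j≢to0 (≡.trans (≡.sym (strictlyInverseˡ j)) (to-cong fromj≈0)))))
      (atZero-zero (strictlyInverseʳ 0#))

    a^qP≈aP : a ↑ q ⊗ P ≈ a ⊗ P
    a^qP≈aP = begin
      a ↑ q ⊗ P
        ≈⟨ *-congʳ (∏.sum-replicate q) ⟨
      ∏.sum {q} (λ _ → a) ⊗ P
        ≈⟨ ∏.∑-distrib-+ {q} (λ _ → a) (λ i → nonzeroPart (from i)) ⟨
      ∏.sum (λ i → a ⊗ nonzeroPart (from i))
        ≈⟨ ∏.sum-cong-≋ {q} (λ i → a⊗nonzeroPart (from i)) ⟩
      ∏.sum (λ i → atZero (from i) ⊗ nonzeroPart (a ⊗ from i))
        ≈⟨ ∏.∑-distrib-+ {q} (λ i → atZero (from i)) (λ i → nonzeroPart (a ⊗ from i)) ⟩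
      ∏.sum (λ i → atZero (from i)) ⊗ ∏.sum (λ i → nonzeroPart (a ⊗ from i))
        ≈⟨ *-cong ∏atZero (sym (∏.sum-cong-≋ {q} (λ i → nonzeroPart-cong (strictlyInverseʳ _)))) ⟩
      a ⊗ ∏.sum (λ i → nonzeroPart (from (to (a ⊗ from i))))
        ≈⟨ *-congˡ (∏.sum-permute (λ i → nonzeroPart (from i)) scale) ⟨
      a ⊗ P ∎

    a^q≈a : a ↑ q ≈ a
    a^q≈a with invertible P P≉0
    ... | P⁻¹ , _ , PP⁻¹≈1 = begin
      a ↑ q                  ≈⟨ *-identityʳ _ ⟨
      a ↑ q ⊗ 1#             ≈⟨ *-congˡ PP⁻¹≈1 ⟨
      a ↑ q ⊗ (P ⊗ P⁻¹)      ≈⟨ *-assoc _ _ _ ⟨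
      a ↑ q ⊗ P ⊗ P⁻¹        ≈⟨ *-congʳ a^qP≈aP ⟩
      a ⊗ P ⊗ P⁻¹            ≈⟨ *-assoc _ _ _ ⟩
      a ⊗ (P ⊗ P⁻¹)          ≈⟨ *-congˡ PP⁻¹≈1 ⟩
      a ⊗ 1#                 ≈⟨ *-identityʳ a ⟩
      a                      ∎

  θ-nonzero : ∀ {x v} → x ⊗ v ≈ 1# → _⟶_ F (just x) (just (x ⊕ v))
  θ-nonzero {x} {v} xv≈1 with x ≟ 0#
  ... | yes x≈0 = contradiction x≈0 (xu≈1⇒x≉0 xv≈1)
  ... | no  x≉0 = just (+-congˡ (inverse-unique (inv-inverseʳ x x≉0) xv≈1))

  -- Both ∞ and 0 are sent to ∞, so an arrow into a finite point starts at a unit.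
  θ-arrow-inverse : ∀ x {β} → _⟶_ F x (just β) → ∃ λ y → ∃ λ v → y ⊗ v ≈ 1# × y ⊕ v ≈ β
  θ-arrow-inverse (just x) arrow with x ≟ 0# | arrow
  ... | no x≉0 | just x+x⁻¹≈β = x , inv x x≉0 , inv-inverseʳ x x≉0 , x+x⁻¹≈β

-- The field with 2^n elements: traces, zeros of D and leaves

module BinaryField {c ℓ} (n : ℕ) (n>2 : n ℕ.> 2) (F : FiniteField c ℓ (2 ℕ.^ n)) where
  open FiniteField F
  open Field F
  open Inverse enumeration using (from)
  open CharacteristicTwo commutativeRing (2^k·1≈0⇒1+1≈0 n q·1≈0)
  open SemiringExp semiring using () renaming (_^_ to _↑_)
  open SemiringMult semiring using (×-cong)
  open import Relation.Binary.Reasoning.Setoid setoid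

  frob-0 : ∀ k {x} → x ≈ 0# → frob k x ≈ 0#
  frob-0 zero    x≈0 = x≈0
  frob-0 (suc k) x≈0 = frob-0 k (trans (*-congˡ x≈0) (zeroʳ _))

  frob-n : ∀ x → frob n x ≈ x
  frob-n x = case x ≟ 0# of λ where
    (yes x≈0) → trans (frob-0 n x≈0) (sym x≈0)
    (no x≉0)  → trans (sym (x^2^k≈frob n x)) (fermat x≉0)

  tr²≈tr : ∀ x → tr n x ⊗ tr n x ≈ tr n x
  tr²≈tr x = x+y≈0⇒x≈y (trans (tr²+tr≈frob+id n x) (trans (+-congʳ (frob-n x)) (x+x≈0 x)))

  tr-x² : ∀ x → tr n (x ⊗ x) ≈ tr n x
  tr-x² x = trans (tr-square n x) (tr²≈tr x)

  tr-dichotomy : ∀ x → tr n x ≈ 0# ⊎ tr n x ≈ 1#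
  tr-dichotomy x with tr n x ≟ 0#
  ... | yes tr≈0 = inj₁ tr≈0
  ... | no  tr≉0 = inj₂ (x+y≈0⇒x≈y (cancelˡ tr≉0 (begin
    tr n x ⊗ (tr n x ⊕ 1#)          ≈⟨ solve 1 (λ t → t :* (t :+ con true) := t :* t :+ t) refl (tr n x) ⟩
    tr n x ⊗ tr n x ⊕ tr n x        ≈⟨ +-congʳ (tr²≈tr x) ⟩
    tr n x ⊕ tr n x                 ≈⟨ x+x≈0 (tr n x) ⟩
    0#                              ∎)))

  Tr≈tr : ∀ x → Tr F n x ≈ tr n x
  Tr≈tr = ∑x^2^j≈tr n

  D≈x²[1+tr] : ∀ {x u} → x ⊗ u ≈ 1# → D F (suc (2 ℕ.^ n)) x ≈ x ⊗ x ⊗ (1# ⊕ tr n u)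
  D≈x²[1+tr] {x} {u} xu≈1 = begin
    D F m x
      ≈⟨ ∑.sum-cong-≋ {suc ℕ.⌊ m /2⌋}
           (λ i → *-congʳ {x ↑ (m ℕ.∸ 2 ℕ.* toℕ i)} (×-cong (dicksonCoeff≡lucasCoeff m i) ([-1]^k≈1 (toℕ i)))) ⟩
    ∑.sum {suc ℕ.⌊ m /2⌋} (λ i → dicksonTerm m x (toℕ i))
      ≈⟨ dickson≈∑ m x (suc ℕ.⌊ m /2⌋) (n<2*[1+⌊n/2⌋] m) ⟨
    dickson m x
      ≈⟨ dickson-1+2^k n xu≈1 ⟩
    x ⊗ frob n x ⊗ (1# ⊕ tr n (u ⊗ u))
      ≈⟨ *-cong (*-congˡ (frob-n x)) (+-congˡ (tr-x² u)) ⟩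
    x ⊗ x ⊗ (1# ⊕ tr n u) ∎
    where
    m = suc (2 ℕ.^ n)

  tr≈1⇒D≈0 : ∀ {x u} → x ⊗ u ≈ 1# → tr n u ≈ 1# → D F (suc (2 ℕ.^ n)) x ≈ 0#
  tr≈1⇒D≈0 {x} {u} xu≈1 tr≈1 = begin
    D F (suc (2 ℕ.^ n)) x       ≈⟨ D≈x²[1+tr] xu≈1 ⟩
    x ⊗ x ⊗ (1# ⊕ tr n u)       ≈⟨ *-congˡ (+-congˡ tr≈1) ⟩
    x ⊗ x ⊗ (1# ⊕ 1#)           ≈⟨ *-congˡ (x+x≈0 1#) ⟩
    x ⊗ x ⊗ 0#                  ≈⟨ zeroʳ _ ⟩
    0#                          ∎

  D≈0⇒tr≈1 : ∀ {x u} → x ⊗ u ≈ 1# → D F (suc (2 ℕ.^ n)) x ≈ 0# → tr n u ≈ 1#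
  D≈0⇒tr≈1 {x} {u} xu≈1 D≈0 =
    sym (x+y≈0⇒x≈y (cancelˡ (⊗-nonzero x≉0 x≉0) (trans (sym (D≈x²[1+tr] xu≈1)) D≈0)))
    where x≉0 = xu≈1⇒x≉0 xu≈1

  -- The bound on the number of roots, run as a search: if the first point is a root it is divided
  -- out, and the other points are tried on the quotient. Injectivity of `f` keeps the factor x + r
  -- nonzero there.
  nonroot : ∀ {d m} (p : Monic d) (f : Fin m → Carrier) → (∀ {i j} → f i ≈ f j → i ≡ j) → d ℕ.< m →
    ∃ λ i → eval p (f i) ≉ 0#
  nonroot {zero}  {suc m} [] f f-injective _ = Fin.zero , λ 1≈0 → 0≉1 (sym 1≈0)
  nonroot {suc d} {suc m} p f f-injective d<m with eval p (f Fin.zero) ≟ 0#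
  ... | no  p[r]≉0 = Fin.zero , p[r]≉0
  ... | yes p[r]≈0 with nonroot (divide (f Fin.zero) p) (λ i → f (Fin.suc i))
                          (λ eq → suc-injective (f-injective eq)) (s<s⁻¹ d<m)
  ...   | i , quotient≉0 = Fin.suc i , λ p[x]≈0 →
    ⊗-nonzero (λ x+r≈0 → 1+i≢0 (f-injective (x+y≈0⇒x≈y x+r≈0))) quotient≉0
      (trans (sym (eval-divide (f Fin.zero) p (f (Fin.suc i))))
             (trans (+-cong p[x]≈0 p[r]≈0) (+-identityˡ 0#)))
    where
    1+i≢0 : Fin.suc i ≢ Fin.zero
    1+i≢0 ()

  -- The trace is a monic polynomial function of degree 2^(n-1), below the number 2^n of points, so
  -- it is not identically zero.
  ∃-tr≈1 : ∃ λ b → tr n b ≈ 1#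
  ∃-tr≈1 = go n ≡.refl (ℕ.<⇒≤ (ℕ.<⇒≤ n>2))
    where
    go : ∀ k → k ≡ n → 1 ℕ.≤ k → ∃ λ b → tr n b ≈ 1#
    go (suc k) ≡.refl _ with nonroot (tracePoly k) from from-injective
      (≡.subst (ℕ._< 2 ℕ.^ suc k) (≡.sym (1+predTraceDegree≡2^k k)) (ℕ.^-monoʳ-< 2 (s<s z<s) (ℕ.n<1+n k)))
    ... | i , p≉0 with tr-dichotomy (from i)
    ...   | inj₁ tr≈0 = contradiction (trans (eval-tracePoly k (from i)) tr≈0) p≉0
    ...   | inj₂ tr≈1 = from i , tr≈1

  tr≈1⇒leaf : ∀ {α u} → α ⊗ u ≈ 1# → tr n u ≈ 1# → Leaf F (just α)
  tr≈1⇒leaf {α} {u} αu≈1 tr≈1 (p , arrow) with θ-arrow-inverse p arrow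
  ... | x , v , xv≈1 , x+v≈α = 0≉1 (begin
    0#                                ≈⟨ x+x≈0 (tr n y) ⟨
    tr n y ⊕ tr n y                   ≈⟨ +-congʳ (tr-x² y) ⟨
    tr n (y ⊗ y) ⊕ tr n y             ≈⟨ tr-+ n (y ⊗ y) y ⟨
    tr n (y ⊗ y ⊕ y)                  ≈⟨ tr-cong n y²+y≈u² ⟩
    tr n (u ⊗ u)                      ≈⟨ tr-x² u ⟩
    tr n u                            ≈⟨ tr≈1 ⟩
    1#                                ∎)
    where
    y = x ⊗ u
    y²+y≈u² : y ⊗ y ⊕ y ≈ u ⊗ u
    y²+y≈u² = begin
      y ⊗ y ⊕ y                              ≈⟨ +-congˡ (*-identityʳ y) ⟨
      -- Replacing 1 by (x + v)u makes the expression homogeneous: x²u² cancels and xv * u² remains.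
      y ⊗ y ⊕ y ⊗ 1#                         ≈⟨ +-congˡ (*-congˡ (trans (*-congʳ x+v≈α) αu≈1)) ⟨
      y ⊗ y ⊕ y ⊗ ((x ⊕ v) ⊗ u)
        ≈⟨ solve 3 (λ x u v → x :* u :* (x :* u) :+ x :* u :* ((x :+ v) :* u) := x :* v :* (u :* u)) refl x u v ⟩
      x ⊗ v ⊗ (u ⊗ u)                        ≈⟨ *-congʳ xv≈1 ⟩
      1# ⊗ (u ⊗ u)                           ≈⟨ *-identityˡ _ ⟩
      u ⊗ u                                  ∎

  tr≈0⇒y²+y≈u² : ∀ {u b} → tr n u ≈ 0# → tr n b ≈ 1# → let y = hilbert90 n (u ⊗ u) b in y ⊗ y ⊕ y ≈ u ⊗ u
  tr≈0⇒y²+y≈u² {u} {b} tr-u≈0 tr-b≈1 = begin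
    hilbert90 n (u ⊗ u) b ⊗ hilbert90 n (u ⊗ u) b ⊕ hilbert90 n (u ⊗ u) b
      ≈⟨ hilbert90-y²+y n (u ⊗ u) b ⟩
    tr n (u ⊗ u) ⊗ frob n b ⊕ u ⊗ u ⊗ (tr n b ⊗ tr n b)
      ≈⟨ +-cong (*-congʳ (trans (tr-x² u) tr-u≈0)) (*-congˡ (trans (tr²≈tr b) tr-b≈1)) ⟩
    0# ⊗ frob n b ⊕ u ⊗ u ⊗ 1#
      ≈⟨ solve 2 (λ f v → con false :* f :+ v :* con true := v) refl (frob n b) (u ⊗ u) ⟩
    u ⊗ u ∎

  -- With x = αy, the two roots of X² + αX + 1 are x and x + α: their product is α²(y² + y) = (αu)²
  -- = 1.
  y²+y≈u²⇒arrow : ∀ {α u y} → α ⊗ u ≈ 1# → y ⊗ y ⊕ y ≈ u ⊗ u → _⟶_ F (just (α ⊗ y)) (just α)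
  y²+y≈u²⇒arrow {α} {u} {y} αu≈1 y²+y≈u² =
    Pointwise.trans trans (θ-nonzero x[x+α]≈1) (just (solve 2 (λ x α → x :+ (x :+ α) := α) refl (α ⊗ y) α))
    where
    x[x+α]≈1 : α ⊗ y ⊗ (α ⊗ y ⊕ α) ≈ 1#
    x[x+α]≈1 = begin
      α ⊗ y ⊗ (α ⊗ y ⊕ α)          ≈⟨ solve 2 (λ α y → α :* y :* (α :* y :+ α) := α :* α :* (y :* y :+ y)) refl α y ⟩
      α ⊗ α ⊗ (y ⊗ y ⊕ y)          ≈⟨ *-congˡ y²+y≈u² ⟩
      α ⊗ α ⊗ (u ⊗ u)              ≈⟨ solve 2 (λ α u → α :* α :* (u :* u) := α :* u :* (α :* u)) refl α u ⟩
      α ⊗ u ⊗ (α ⊗ u)              ≈⟨ *-cong αu≈1 αu≈1 ⟩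
      1# ⊗ 1#                      ≈⟨ *-identityˡ 1# ⟩
      1#                           ∎

  leaf⇒tr≈1 : ∀ {α u} → α ⊗ u ≈ 1# → Leaf F (just α) → tr n u ≈ 1#
  leaf⇒tr≈1 {α} {u} αu≈1 leaf with tr-dichotomy u | ∃-tr≈1
  ... | inj₂ tr≈1 | _          = tr≈1
  ... | inj₁ tr≈0 | b , tr-b≈1 =
    contradiction (_ , y²+y≈u²⇒arrow αu≈1 (tr≈0⇒y²+y≈u² tr≈0 tr-b≈1)) leaf

  -- An element and its inverse with different traces

  -- The product expands to y⁴ + y, which has at most 4 roots, while n > 2 gives at least 8 points.
  -- It is kept factored because y, y + 1 and y² + y + 1 must each be inverted.
  ∃-y⁴+y≉0 : ∃ λ y → y ⊗ ((y ⊕ 1#) ⊗ (y ⊗ y ⊕ y ⊕ 1#)) ≉ 0#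
  ∃-y⁴+y≉0 with nonroot (0# ∷ 1# ∷ 0# ∷ 0# ∷ []) from from-injective (ℕ.<-≤-trans (ℕ.m<m+n 4 {4} z<s) (ℕ.^-monoʳ-≤ 2 n>2))
  ... | i , p≉0 = from i , λ y⁴+y≈0 → p≉0 (trans (solve 1 (λ y →
    con false :+ y :* (con true :+ y :* (con false :+ y :* (con false :+ y :* con true))) :=
    y :* ((y :+ con true) :* (y :* y :+ y :+ con true))) refl (from i)) y⁴+y≈0)

  -- With z = y² + y we have 1/(az) = 1/(ay) + 1/(ay + a).  If the trace agreed on w and 1/w for
  -- w = ay, ay + a and az, then tr(az) = tr(ay) + tr(ay + a) = tr a, i.e. tr(a(z + 1)) = 0;
  -- so a is chosen such that a(z + 1) has trace 1, which is possible as soon as z ≉ 1.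
  ∃-tr≉tr : ∀ {y b} → y ⊗ ((y ⊕ 1#) ⊗ (y ⊗ y ⊕ y ⊕ 1#)) ≉ 0# → tr n b ≈ 1# →
    ∃ λ w → ∃ λ w⁻¹ → w ⊗ w⁻¹ ≈ 1# × tr n w ≉ tr n w⁻¹
  ∃-tr≉tr {y} {b} y⁴+y≉0 tr-b≈1 = search
    where
    z = y ⊗ y ⊕ y

    y≉0 : y ≉ 0#
    y≉0 y≈0 = y⁴+y≉0 (trans (*-congʳ y≈0) (zeroˡ _))

    y+1≉0 : y ⊕ 1# ≉ 0#
    y+1≉0 y+1≈0 = y⁴+y≉0 (trans (*-congˡ (trans (*-congʳ y+1≈0) (zeroˡ _))) (zeroʳ _))

    z+1≉0 : z ⊕ 1# ≉ 0#
    z+1≉0 z+1≈0 = y⁴+y≉0 (trans (*-congˡ (trans (*-congˡ z+1≈0) (zeroʳ _))) (zeroʳ _))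

    b≉0 : b ≉ 0#
    b≉0 b≈0 = 0≉1 (begin
      0#                  ≈⟨ x+x≈0 (tr n b) ⟨
      tr n b ⊕ tr n b     ≈⟨ tr-+ n b b ⟨
      tr n (b ⊕ b)        ≈⟨ tr-cong n (trans (+-congʳ b≈0) (+-identityˡ b)) ⟩
      tr n b              ≈⟨ tr-b≈1 ⟩
      1#                  ∎)

    y′ = inv y y≉0
    s′ = inv (y ⊕ 1#) y+1≉0
    e  = inv (z ⊕ 1#) z+1≉0
    a  = b ⊗ e
    a′ = inv b b≉0 ⊗ (z ⊕ 1#)

    product-inverse : ∀ {x x′ y y′} → x ⊗ x′ ≈ 1# → y ⊗ y′ ≈ 1# → x ⊗ y ⊗ (x′ ⊗ y′) ≈ 1#
    product-inverse {x} {x′} {y} {y′} xx′≈1 yy′≈1 = begin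
      x ⊗ y ⊗ (x′ ⊗ y′)       ≈⟨ solve 4 (λ x x′ y y′ → x :* y :* (x′ :* y′) := x :* x′ :* (y :* y′)) refl x x′ y y′ ⟩
      x ⊗ x′ ⊗ (y ⊗ y′)       ≈⟨ *-cong xx′≈1 yy′≈1 ⟩
      1# ⊗ 1#                 ≈⟨ *-identityˡ 1# ⟩
      1#                      ∎

    yy′≈1 = inv-inverseʳ y y≉0
    ss′≈1 = inv-inverseʳ (y ⊕ 1#) y+1≉0
    [z+1]e≈1 = inv-inverseʳ (z ⊕ 1#) z+1≉0

    aa′≈1 : a ⊗ a′ ≈ 1#
    aa′≈1 = product-inverse (inv-inverseʳ b b≉0) (trans (*-comm e _) [z+1]e≈1)

    zz′≈1 : z ⊗ (y′ ⊗ s′) ≈ 1#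
    zz′≈1 = trans (*-congʳ (solve 1 (λ y → y :* y :+ y := y :* (y :+ con true)) refl y))
                  (product-inverse yy′≈1 ss′≈1)

    z′≈y′+s′ : y′ ⊗ s′ ≈ y′ ⊕ s′
    z′≈y′+s′ = begin
      y′ ⊗ s′
        ≈⟨ solve 3 (λ y y′ s′ → y′ :* s′ := (y :+ con true) :* s′ :* y′ :+ y :* y′ :* s′) refl y y′ s′ ⟩
      (y ⊕ 1#) ⊗ s′ ⊗ y′ ⊕ y ⊗ y′ ⊗ s′
        ≈⟨ +-cong (trans (*-congʳ ss′≈1) (*-identityˡ y′)) (trans (*-congʳ yy′≈1) (*-identityˡ s′)) ⟩
      y′ ⊕ s′ ∎

    not-all-equal : tr n (a ⊗ y) ≈ tr n (a′ ⊗ y′) → tr n (a ⊗ (y ⊕ 1#)) ≈ tr n (a′ ⊗ s′) →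
      tr n (a ⊗ z) ≉ tr n (a′ ⊗ (y′ ⊗ s′))
    not-all-equal eq-y eq-s eq-z = 0≉1 (begin
      0#
        ≈⟨ x+x≈0 (tr n (a ⊗ z)) ⟨
      tr n (a ⊗ z) ⊕ tr n (a ⊗ z)
        ≈⟨ +-congʳ eq-z ⟩
      tr n (a′ ⊗ (y′ ⊗ s′)) ⊕ tr n (a ⊗ z)
        ≈⟨ +-congʳ (tr-cong n (trans (*-congˡ z′≈y′+s′) (distribˡ a′ y′ s′))) ⟩
      tr n (a′ ⊗ y′ ⊕ a′ ⊗ s′) ⊕ tr n (a ⊗ z)
        ≈⟨ +-congʳ (trans (tr-+ n _ _) (sym (+-cong eq-y eq-s))) ⟩
      tr n (a ⊗ y) ⊕ tr n (a ⊗ (y ⊕ 1#)) ⊕ tr n (a ⊗ z)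
        ≈⟨ trans (tr-+ n _ _) (+-congʳ (tr-+ n _ _)) ⟨
      tr n (a ⊗ y ⊕ a ⊗ (y ⊕ 1#) ⊕ a ⊗ z)
        ≈⟨ tr-cong n (solve 4 (λ b e y z → b :* e :* y :+ b :* e :* (y :+ con true) :+ b :* e :* z :=
             b :* ((z :+ con true) :* e)) refl b e y z) ⟩
      tr n (b ⊗ ((z ⊕ 1#) ⊗ e))
        ≈⟨ tr-cong n (trans (*-congˡ [z+1]e≈1) (*-identityʳ b)) ⟩
      tr n b
        ≈⟨ tr-b≈1 ⟩
      1# ∎)

    search : ∃ λ w → ∃ λ w⁻¹ → w ⊗ w⁻¹ ≈ 1# × tr n w ≉ tr n w⁻¹
    search = case tr n (a ⊗ y) ≟ tr n (a′ ⊗ y′) of λ where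
      (no ≉-y)   → _ , _ , product-inverse aa′≈1 yy′≈1 , ≉-y
      (yes eq-y) → case tr n (a ⊗ (y ⊕ 1#)) ≟ tr n (a′ ⊗ s′) of λ where
        (no ≉-s)   → _ , _ , product-inverse aa′≈1 ss′≈1 , ≉-s
        (yes eq-s) → _ , _ , product-inverse aa′≈1 zz′≈1 , not-all-equal eq-y eq-s

  -- Comparison of the two sets

  Tr≉⇒tr≉ : ∀ {x y} → Tr F n x ≉ Tr F n y → tr n x ≉ tr n y
  Tr≉⇒tr≉ {x} {y} Tr≉ tr≈ = Tr≉ (trans (Tr≈tr x) (trans tr≈ (sym (Tr≈tr y))))

  tr≉⇒Tr≉ : ∀ {x y} → tr n x ≉ tr n y → Tr F n x ≉ Tr F n y
  tr≉⇒Tr≉ {x} {y} tr≉ Tr≈ = tr≉ (trans (sym (Tr≈tr x)) (trans Tr≈ (Tr≈tr y)))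

  tr⇒L-B : ∀ {α u} → α ⊗ u ≈ 1# → tr n u ≈ 1# → tr n α ≉ tr n u → L-B F n α
  tr⇒L-B αu≈1 tr≈1 tr≉ = tr≈1⇒leaf αu≈1 tr≈1 , α≉0 ,
    -- `B` inverts α by its own `inv`, which uniqueness of inverses identifies with u.
    tr≉⇒Tr≉ (λ eq → tr≉ (trans eq (tr-cong n (inverse-unique (inv-inverseʳ _ α≉0) αu≈1))))
    where α≉0 = xu≈1⇒x≉0 αu≈1

  -- The two traces are 0 and 1 in some order; the element whose inverse has trace 1 is the leaf.
  tr≉⇒∃-L-B : ∀ {w w⁻¹} → w ⊗ w⁻¹ ≈ 1# → tr n w ≉ tr n w⁻¹ → Satisfiable (L-B F n)
  tr≉⇒∃-L-B {w} {w⁻¹} ww⁻¹≈1 tr≉ with tr-dichotomy w | tr-dichotomy w⁻¹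
  ... | _         | inj₂ tr′≈1 = w , tr⇒L-B ww⁻¹≈1 tr′≈1 tr≉
  ... | inj₂ tr≈1 | inj₁ _     = w⁻¹ , tr⇒L-B (trans (*-comm w⁻¹ w) ww⁻¹≈1) tr≈1 (λ eq → tr≉ (sym eq))
  ... | inj₁ tr≈0 | inj₁ tr′≈0 = contradiction (trans tr≈0 (sym tr′≈0)) tr≉

  L-B-satisfiable : Satisfiable (L-B F n)
  L-B-satisfiable =
    let _ , y⁴+y≉0           = ∃-y⁴+y≉0
        _ , tr-b≈1           = ∃-tr≈1
        _ , _ , ww⁻¹≈1 , tr≉ = ∃-tr≉tr y⁴+y≉0 tr-b≈1
    in tr≉⇒∃-L-B ww⁻¹≈1 tr≉

  -- Read for the pair (α⁻¹, α), the formula for D turns the condition at α⁻¹ into one on tr α: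
  -- equal traces would make D vanish there too.
  T⊆L-B : T F (suc (2 ℕ.^ n)) ⊆ L-B F n
  T⊆L-B {α} (α≉0 , Dα≈0 , Dα⁻¹≉0) = tr⇒L-B αα⁻¹≈1 tr≈1 (λ eq →
    Dα⁻¹≉0 (tr≈1⇒D≈0 (trans (*-comm _ α) αα⁻¹≈1) (trans eq tr≈1)))
    where
    αα⁻¹≈1 = inv-inverseʳ α α≉0
    tr≈1 = D≈0⇒tr≈1 αα⁻¹≈1 Dα≈0

  L-B⊆T : L-B F n ⊆ T F (suc (2 ℕ.^ n))
  L-B⊆T {α} (leaf , α≉0 , Tr≉) = α≉0 , tr≈1⇒D≈0 αα⁻¹≈1 tr≈1 , λ Dα⁻¹≈0 →
    Tr≉⇒tr≉ Tr≉ (trans (D≈0⇒tr≈1 (trans (*-comm _ α) αα⁻¹≈1) Dα⁻¹≈0) (sym tr≈1))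
    where
    αα⁻¹≈1 = inv-inverseʳ α α≉0
    tr≈1 = leaf⇒tr≈1 αα⁻¹≈1 leaf

lemma4p15 : ∀ {c ℓ} (n : ℕ) → n > 2 → (F : FiniteField c ℓ (2 ^ n)) →
    Satisfiable (L-B F n) × (T F (suc (2 ^ n)) ≐ L-B F n)
lemma4p15 n n>2 F = L-B-satisfiable , T⊆L-B , L-B⊆T
  where
  open BinaryField n n>2 F
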